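{- Let $s\ge0$ be an integer, $h\in\mathbb C\setminus\{0\}$, and let $q\in\mathbb C\setminus\{0\}$ be either $1$ or not a root of unity. Let $0\le k\le n$. If $s\ne1$ and $s\ne0$, then $$S_{s,h,q}[n,k]=\frac{h^{n-k}[s]_q^n}{[k]_{q^{1-s}}!\,[1-s]_q^k}\sum_{j=0}^k(-1)^{k-j}q^{\binom{k-j}2(1-s)}\genfrac{[}{]}{0pt}{}{k}{j}_{q^{1-s}}\prod_{t=1}^n[(j/s)+t-j-1]_{q^s}.$$ If $s=0$, then $$S_{0,h,q}[n,k]=\frac{h^{n-k}}{[k]_q!}\sum_{j=0}^k(-1)^{k-j}q^{\binom{k-j}2}\genfrac{[}{]}{0pt}{}{k}{j}_q[j]_q^n .$$
   Context: $[x]_p=\frac{p^x-1}{p-1}$ if $p\ne1$ and $[x]_1=x$; for the non-integer argument $x=(j/s)+t-j-1$ with $p=q^s$, the power $p^{x}$ means $q^{sx}=q^{j+s(t-j-1)}$. $[n]_p!=[n]_p[n-1]_p\cdots[1]_p$, and $\genfrac{[}{]}{0pt}{}{k}{j}_p=\frac{[k]_p!}{[j]_p!\,[k-j]_p!}$. $0^0=1$. The numbers $S_{s,h,q}[n,k]$ are the coefficients in $(VU)^n=\sum_{k=0}^nS_{s,h,q}[n,k]V^{sn-(s-1)k}U^k$, where $UV-qVU=hV^s$; equivalently they are determined by $S_{s,h,q}[n,k]=q^{s(n-1)-(s-1)(k-1)}S_{s,h,q}[n-1,k-1]+h[s(n-1)-(s-1)k]_q\,S_{s,h,q}[n-1,k]$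 for $n,k\ge1$, with $S_{s,h,q}[n,0]=S_{s,h,q}[0,n]=\delta_{0,n}$. -}

module Defs where

open import Algebra.Apartness.Bundles using (HeytingField; HeytingCommutativeRing)
open import Algebra.Bundles using (CommutativeRing; CommutativeSemiring)
import Algebra.Apartness.Properties.HeytingCommutativeRing as ApartnessProperties
import Algebra.Definitions.RawMonoid as RawMonoidDefinitions
import Algebra.Definitions.RawSemiring as RawSemiringDefinitions
import Algebra.Properties.CommutativeSemiring.Exp as ExpProperties
import Algebra.Properties.Monoid.Sum as SumProperties
import Algebra.Properties.Ring as RingProperties
open import Data.Empty using (⊥-elim)
open import Data.Fin.Base using (Fin)
open import Data.Integer.Base as ℤ using (ℤ; +_; -[1+_]; 0ℤ; 1ℤ)
import Data.Integer.Properties as ℤₚ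
open import Data.Nat.Base as ℕ using (ℕ; zero; suc; _∸_)
open import Data.Product.Base using (_,_; proj₁; proj₂)
open import Data.Sum.Base using (_⊎_; inj₁; inj₂)
import Level
open import Relation.Binary.PropositionalEquality.Core as ≡ using (_≢_)
import Relation.Binary.Reasoning.Setoid as ≈-Reasoning

CharacteristicZero : ∀ {c ℓ₁ ℓ₂} → HeytingField c ℓ₁ ℓ₂ → Set ℓ₂
CharacteristicZero K = ∀ n → (suc n × 1#) # 0#
  where
  open HeytingField K
  open HeytingCommutativeRing heytingCommutativeRing using (commutativeRing)
  open CommutativeRing commutativeRing using (+-rawMonoid)
  open RawMonoidDefinitions +-rawMonoid using (_×_)

-- The base field stands for ℂ.  In a Heyting field "x ≠ y" is the apartness
-- x # y, i.e. invertibility of x - y; no decidable equality is assumed.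
module GeneralizedStirling {c ℓ₁ ℓ₂} (K : HeytingField c ℓ₁ ℓ₂)
                           (char0 : CharacteristicZero K) where

  open HeytingField K
    hiding (refl; sym; trans; reflexive; setoid)
  open HeytingCommutativeRing heytingCommutativeRing using (commutativeRing)
  open CommutativeRing commutativeRing
    using (refl; sym; trans; reflexive; setoid; ring; commutativeSemiring;
           +-monoid)
  open CommutativeSemiring commutativeSemiring using (rawSemiring)
  open ApartnessProperties heytingCommutativeRing
    using (1#0; x-0≈x; x#0y#0→xy#0; #-congʳ; invertibleˡ⇒#)
  open ExpProperties commutativeSemiring using (^-congˡ; ^-assocʳ; ^-distrib-*)
  open RingProperties ring using (-‿distribʳ-*)
  open RawSemiringDefinitions rawSemiring public using (_^_; _×_; product)
  open SumProperties +-monoid public using (sum-syntax; sum⁺-syntax)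

  infixl 10 prod-syntax

  prod-syntax : ∀ n → (Fin n → Carrier) → Carrier
  prod-syntax _ = product

  syntax prod-syntax n (λ i → x) = ∏[ i < n ] x

  inv : (x : Carrier) → x # 0# → Carrier
  inv x x#0 = proj₁ (#⇒invertible x#0)

  infixl 7 _/_[_]
  _/_[_] : (x y : Carrier) → y # 0# → Carrier
  x / y [ y#0 ] = x * inv y y#0

  fromℤ : ℤ → Carrier
  fromℤ (+ n)    = n × 1#
  fromℤ -[1+ n ] = - (suc n × 1#)

  inv-inverseˡ : ∀ {x} (x#0 : x # 0#) → inv x x#0 * x ≈ 1#
  inv-inverseˡ {x} x#0 =
    trans (*-congˡ (sym (x-0≈x x))) (proj₁ (proj₂ (#⇒invertible x#0)))

  inverse#0 : ∀ {x y} → y * x ≈ 1# → y # 0#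
  inverse#0 {x} {y} yx≈1 = invertibleˡ⇒#
    (x , trans (*-congˡ (x-0≈x y)) (trans (*-comm x y) yx≈1))

  inv#0 : ∀ {x} (x#0 : x # 0#) → inv x x#0 # 0#
  inv#0 x#0 = inverse#0 (inv-inverseˡ x#0)

  #⇒-#0 : ∀ {x y} → x # y → x - y # 0#
  #⇒-#0 {x} {y} x#y with u , ux≈1 , _ ← #⇒invertible x#y =
    invertibleˡ⇒# (u , trans (*-congˡ (x-0≈x (x - y))) ux≈1)

  -#0⇒# : ∀ {x y} → x - y # 0# → x # y
  -#0⇒# {x} {y} x-y#0 = invertibleˡ⇒# (inv (x - y) x-y#0 , inv-inverseˡ x-y#0)

  -‿#0 : ∀ {x} → x # 0# → - x # 0#
  -‿#0 x#0 = #-congʳ (+-identityˡ _) (#⇒-#0 (#-sym x#0))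

  1^n≈1 : ∀ n → 1# ^ n ≈ 1#
  1^n≈1 zero    = refl
  1^n≈1 (suc n) = trans (*-identityˡ _) (1^n≈1 n)

  ^-inverseˡ : ∀ {x y} n → y * x ≈ 1# → y ^ n * x ^ n ≈ 1#
  ^-inverseˡ {x} {y} n yx≈1 =
    trans (sym (^-distrib-* y x n)) (trans (^-congˡ n yx≈1) (1^n≈1 n))

  inverse#1 : ∀ {x y} → y * x ≈ 1# → x # 1# → y # 1#
  inverse#1 {x} {y} yx≈1 x#1 =
    -#0⇒# (#-congʳ y[1-x]≈y-1
      (x#0y#0→xy#0 (inverse#0 yx≈1) (#⇒-#0 (#-sym x#1))))
    where
    open ≈-Reasoning setoid
    y[1-x]≈y-1 : y * (1# - x) ≈ y - 1#
    y[1-x]≈y-1 = begin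
      y * (1# - x)         ≈⟨ distribˡ y 1# (- x) ⟩
      y * 1# + y * - x     ≈⟨ +-cong (*-identityʳ y) (sym (-‿distribʳ-* y x)) ⟩
      y - y * x            ≈⟨ +-congˡ (-‿cong yx≈1) ⟩
      y - 1#               ∎

  ^-#0 : ∀ {x} n → x # 0# → x ^ n # 0#
  ^-#0 zero    x#0 = 1#0
  ^-#0 (suc n) x#0 = x#0y#0→xy#0 x#0 (^-#0 n x#0)

  *-#0 : ∀ {x y} → x # 0# → y # 0# → x * y # 0#
  *-#0 = x#0y#0→xy#0

  fromℤ-#0 : ∀ {z} → z ≢ 0ℤ → fromℤ z # 0#
  fromℤ-#0 {+ zero}    z≢0 = ⊥-elim (z≢0 ≡.refl)
  fromℤ-#0 {+ suc n}   z≢0 = char0 n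
  fromℤ-#0 { -[1+ n ]} z≢0 = -‿#0 (char0 n)

  +≢0 : ∀ {n} → n ≢ 0 → + n ≢ 0ℤ
  +≢0 n≢0 eq = n≢0 (ℤₚ.+-injective eq)

  1-≢0 : ∀ {n} → n ≢ 1 → 1ℤ ℤ.- + n ≢ 0ℤ
  1-≢0 {n} n≢1 eq =
    n≢1 (≡.sym (ℤₚ.+-injective (ℤₚ.i-j≡0⇒i≡j 1ℤ (+ n) eq)))

  NotRootOfUnity : Carrier → Set ℓ₂
  NotRootOfUnity q = ∀ m → q ^ suc m # 1#

  record Parameter : Set (c Level.⊔ ℓ₁ Level.⊔ ℓ₂) where
    constructor parameter
    field
      value          : Carrier
      nonzero        : value # 0#
      one-or-nonroot : value ≈ 1# ⊎ NotRootOfUnity value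

  open Parameter public

  infixr 8 _^ℤ_
  _^ℤ_ : Parameter → ℤ → Carrier
  q ^ℤ (+ n)    = value q ^ n
  q ^ℤ -[1+ n ] = inv (value q) (nonzero q) ^ suc n

  ^ℤ-#0 : ∀ q z → q ^ℤ z # 0#
  ^ℤ-#0 q (+ n)    = ^-#0 n (nonzero q)
  ^ℤ-#0 q -[1+ n ] = ^-#0 (suc n) (inv#0 (nonzero q))

  ^ℤ-≈1 : ∀ q z → value q ≈ 1# → q ^ℤ z ≈ 1#
  ^ℤ-≈1 q (+ n)    q≈1 = trans (^-congˡ n q≈1) (1^n≈1 n)
  ^ℤ-≈1 q -[1+ n ] q≈1 = trans (^-congˡ (suc n) inv≈1) (1^n≈1 (suc n))
    where
    inv≈1 : inv (value q) (nonzero q) ≈ 1#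
    inv≈1 = trans (sym (*-identityʳ _))
           (trans (*-congˡ (sym q≈1)) (inv-inverseˡ (nonzero q)))

  inv-nonroot : ∀ q → NotRootOfUnity (value q) →
                NotRootOfUnity (inv (value q) (nonzero q))
  inv-nonroot q r m =
    inverse#1 (^-inverseˡ (suc m) (inv-inverseˡ (nonzero q))) (r m)

  ^-nonroot : ∀ {x} m → NotRootOfUnity x → NotRootOfUnity (x ^ suc m)
  ^-nonroot {x} m r n =
    #-congʳ (sym (^-assocʳ x (suc m) (suc n))) (r (n ℕ.+ m ℕ.* suc n))

  ^ℤ-#1 : ∀ q {z} → z ≢ 0ℤ → NotRootOfUnity (value q) → q ^ℤ z # 1#
  ^ℤ-#1 q {+ zero}    z≢0 r = ⊥-elim (z≢0 ≡.refl)
  ^ℤ-#1 q {+ suc n}   z≢0 r = r n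
  ^ℤ-#1 q { -[1+ n ]} z≢0 r = inv-nonroot q r n

  ^ℤ-one-or-nonroot : ∀ q z → value q ≈ 1# ⊎ NotRootOfUnity (value q) →
                      q ^ℤ z ≈ 1# ⊎ NotRootOfUnity (q ^ℤ z)
  ^ℤ-one-or-nonroot q z         (inj₁ q≈1) = inj₁ (^ℤ-≈1 q z q≈1)
  ^ℤ-one-or-nonroot q (+ zero)  (inj₂ r)   = inj₁ refl
  ^ℤ-one-or-nonroot q (+ suc m) (inj₂ r)   = inj₂ (^-nonroot m r)
  ^ℤ-one-or-nonroot q -[1+ m ]  (inj₂ r)   =
    inj₂ (^-nonroot m (inv-nonroot q r))

  nonroot⇒-1#0 : ∀ {x} → NotRootOfUnity x → x - 1# # 0#
  nonroot⇒-1#0 r = #⇒-#0 (#-congʳ (*-identityʳ _) (r 0))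

  infixr 8 _^ᴾ_
  _^ᴾ_ : Parameter → ℤ → Parameter
  q ^ᴾ z = parameter (q ^ℤ z) (^ℤ-#0 q z)
                     (^ℤ-one-or-nonroot q z (one-or-nonroot q))

  -- [x]_p, given the value pˣ of "p to the power x" and the element x of K.
  -- Passing pˣ separately accommodates non-integer x.
  qNumber : Parameter → (pˣ x : Carrier) → Carrier
  qNumber p pˣ x with one-or-nonroot p
  ... | inj₁ _ = x
  ... | inj₂ r = (pˣ - 1#) / (value p - 1#) [ nonroot⇒-1#0 r ]

  [_]⟨_⟩ : ℤ → Parameter → Carrier
  [ z ]⟨ p ⟩ = qNumber p (p ^ℤ z) (fromℤ z)

  -- [j/s + i]_p for p = qˢ.  The power p^(j/s + i) means q^(j + si).
  fractionalQNumber : (q : Parameter) (s : ℕ) → s ≢ 0 → (j i : ℤ) → Carrier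
  fractionalQNumber q s s≢0 j i =
    qNumber (q ^ᴾ + s)
            (q ^ℤ (j ℤ.+ + s ℤ.* i))
            (fromℤ j / fromℤ (+ s) [ fromℤ-#0 (+≢0 s≢0) ] + fromℤ i)

  []-#0 : ∀ p {z} → z ≢ 0ℤ → [ z ]⟨ p ⟩ # 0#
  []-#0 p z≢0 with one-or-nonroot p
  ... | inj₁ _ = fromℤ-#0 z≢0
  ... | inj₂ r = *-#0 (#⇒-#0 (^ℤ-#1 p z≢0 r)) (inv#0 (nonroot⇒-1#0 r))

  [_]!⟨_⟩ : ℕ → Parameter → Carrier
  [ zero  ]!⟨ p ⟩ = 1#
  [ suc n ]!⟨ p ⟩ = [ + suc n ]⟨ p ⟩ * [ n ]!⟨ p ⟩

  []!-#0 : ∀ n p → [ n ]!⟨ p ⟩ # 0#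
  []!-#0 zero    p = 1#0
  []!-#0 (suc n) p = *-#0 ([]-#0 p {+ suc n} (λ ())) ([]!-#0 n p)

  -- Meaningful for j ≤ k only, since k ∸ j is truncated.
  qBinomial : Parameter → (k j : ℕ) → Carrier
  qBinomial p k j =
    [ k ]!⟨ p ⟩ / ([ j ]!⟨ p ⟩ * [ k ∸ j ]!⟨ p ⟩)
      [ *-#0 ([]!-#0 j p) ([]!-#0 (k ∸ j) p) ]

  -- S s h q n k is the coefficient of V^(sn-(s-1)k) U^k in (VU)^n, where
  -- UV - qVU = hV^s, given by the recurrence that determines it.
  S : (s : ℕ) (h : Carrier) (q : Parameter) (n k : ℕ) → Carrier
  S s h q zero    zero    = 1#
  S s h q zero    (suc k) = 0#
  S s h q (suc n) zero    = 0#
  S s h q (suc n) (suc k) =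
      q ^ℤ (+ s ℤ.* + n ℤ.- (+ s ℤ.- 1ℤ) ℤ.* + k) * S s h q n k
    + h * [ + s ℤ.* + n ℤ.- (+ s ℤ.- 1ℤ) ℤ.* + suc k ]⟨ q ⟩ * S s h q n (suc k)

{-# OPTIONS --safe #-}

module Submission where

open import Defs
open import Algebra.Apartness.Bundles using (HeytingCommutativeRing; HeytingField)
open import Algebra.Bundles using (CommutativeRing; Monoid)
import Algebra.Properties.CommutativeMonoid.Sum as CommutativeMonoidSum
import Algebra.Properties.CommutativeSemiring.Exp as Exp
import Algebra.Properties.Monoid.Sum as MonoidSum
import Algebra.Properties.Ring as RingProperties
import Algebra.Properties.Semiring.Sum as SemiringSum
import Algebra.Solver.Ring.NaturalCoefficients.Default as SemiringSolver
open import Data.Fin.Base as Fin using (Fin; toℕ)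
open import Data.Fin.Properties using (toℕ≤pred[n]; toℕ-inject₁; toℕ-fromℕ)
open import Data.Integer.Base as ℤ using (ℤ; +_; -[1+_]; 0ℤ; 1ℤ)
import Data.Integer.Properties as ℤₚ
import Data.Integer.Tactic.RingSolver as ℤ-Solver
open import Data.Nat.Base as ℕ using (ℕ; zero; suc; _≤_; _∸_)
open import Data.Nat.Combinatorics using (_C_; nC1≡n; nCk+nC[k+1]≡[n+1]C[k+1])
import Data.Nat.Properties as ℕₚ
open import Data.Product.Base using (_×_; _,_)
open import Data.Sum.Base using (_⊎_; inj₁; inj₂)
open import Relation.Binary.PropositionalEquality.Core as ≡ using (_≡_; _≢_)
import Relation.Binary.Reasoning.Setoid as ≈-Reasoning

-- Put u(m) = (-1)^m p^C(m,2) / [m]_p!, v(j) = 1 / [j]_p!, p = q^(1-s),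
-- x(n,k) = sn - (s-1)k, P(n,j) = ∏_{i<n} [x(i,j)]_q and
-- F(n,k) = ∑_{m+j=k} u(m) v(j) P(n,j).  Since [s]_q [j/s + t - j - 1]_{q^s} =
-- [x(t-1,j)]_q, both formulas say that [1-s]_q^k S[n,k] = h^(n-k) F(n,k).
-- For m + j = k,
--   [x(n,j)]_q = [x(n,k)]_q - q^x(n,j) [1-s]_q [m]_p,
-- and [m]_p u(m) = -p^(m-1) u(m-1), so that
--   F(n+1,k) = [x(n,k)]_q F(n,k) + [1-s]_q q^x(n,k-1) F(n,k-1),
-- which is the recurrence of S up to the powers of h and [1-s]_q.  The initial
-- value F(0,k) = 0 for k > 0 is a case of the q-binomial theorem.

-- Powers with integer exponent in a monoid.

module ℤ-Power {c ℓ} (M : Monoid c ℓ) where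
  open Monoid M
  open ≈-Reasoning setoid

  -- A map sending the successor to multiplication by a fixed invertible
  -- element is z ↦ gᶻ, whatever formula defines it on negative integers.
  homo : ∀ g g′ → g′ ∙ g ≈ ε → (f : ℤ → Carrier) → f 0ℤ ≈ ε →
         (∀ z → f (ℤ.suc z) ≈ g ∙ f z) →
         ∀ x y → f (x ℤ.+ y) ≈ f x ∙ f y
  homo g g′ g′g≈ε f f0≈ε f-suc = go
    where
    f-pred : ∀ z → f (ℤ.pred z) ≈ g′ ∙ f z
    f-pred z = begin
      f (ℤ.pred z)                  ≈⟨ identityˡ _ ⟨
      ε ∙ f (ℤ.pred z)              ≈⟨ ∙-congʳ g′g≈ε ⟨
      (g′ ∙ g) ∙ f (ℤ.pred z)       ≈⟨ assoc _ _ _ ⟩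
      g′ ∙ (g ∙ f (ℤ.pred z))       ≈⟨ ∙-congˡ (f-suc (ℤ.pred z)) ⟨
      g′ ∙ f (ℤ.suc (ℤ.pred z))     ≡⟨ ≡.cong (λ w → g′ ∙ f w) (ℤₚ.suc-pred z) ⟩
      g′ ∙ f z                      ∎

    -- One induction step for both directions: `a` is 1 or -1, and `b` is then `g` or `g′`.
    step : ∀ a {b} x y → (∀ z → f (a ℤ.+ z) ≈ b ∙ f z) →
           f (x ℤ.+ y) ≈ f x ∙ f y → f ((a ℤ.+ x) ℤ.+ y) ≈ f (a ℤ.+ x) ∙ f y
    step a {b} x y f-a ih = begin
      f ((a ℤ.+ x) ℤ.+ y)  ≡⟨ ≡.cong f (ℤₚ.+-assoc a x y) ⟩
      f (a ℤ.+ (x ℤ.+ y))  ≈⟨ f-a (x ℤ.+ y) ⟩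
      b ∙ f (x ℤ.+ y)      ≈⟨ ∙-congˡ ih ⟩
      b ∙ (f x ∙ f y)      ≈⟨ assoc _ _ _ ⟨
      (b ∙ f x) ∙ f y      ≈⟨ ∙-congʳ (f-a x) ⟨
      f (a ℤ.+ x) ∙ f y    ∎

    -- Kept apart from `go` because the negative branch starts from it too, and a call of `go` at
    -- `0ℤ` from there would not be a structural descent.
    0-case : ∀ y → f (0ℤ ℤ.+ y) ≈ f 0ℤ ∙ f y
    0-case y = begin
      f (0ℤ ℤ.+ y)  ≡⟨ ≡.cong f (ℤₚ.+-identityˡ y) ⟩
      f y           ≈⟨ identityˡ _ ⟨
      ε ∙ f y       ≈⟨ ∙-congʳ f0≈ε ⟨
      f 0ℤ ∙ f y    ∎

    go : ∀ x y → f (x ℤ.+ y) ≈ f x ∙ f y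
    go (+ zero)      y = 0-case y
    go (+ suc n)     y = step 1ℤ (+ n) y f-suc (go (+ n) y)
    go -[1+ zero ]   y = step ℤ.-1ℤ 0ℤ y f-pred (0-case y)
    go -[1+ suc n ]  y = step ℤ.-1ℤ -[1+ n ] y f-pred (go -[1+ n ] y)

module Stirling {c ℓ₁ ℓ₂} (K : HeytingField c ℓ₁ ℓ₂)
                (char0 : CharacteristicZero K) where

  open HeytingField K using (heytingCommutativeRing)
  open HeytingCommutativeRing heytingCommutativeRing using (commutativeRing; _#_)
  open CommutativeRing commutativeRing hiding (zero)
  open GeneralizedStirling K char0 hiding (_×_)
  open Exp commutativeSemiring using (^-congˡ; ^-homo-*)
  open RingProperties ring using (-1*x≈-x)
  open CommutativeMonoidSum +-commutativeMonoid using (∑-distrib-+; sum-cong-≋)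
  open SemiringSum semiring using (*-distribˡ-sum)
  open SemiringSolver commutativeSemiring using (solve; _:+_; _:*_; _:=_)
  open ≈-Reasoning setoid

  module ∏ = MonoidSum *-monoid

  -- Signs and inverses in the field.

  -- The solver handles commutative semirings only, so a difference is written `x + -1# * y` and
  -- `-1#` enters the solver as an ordinary variable.
  -1# : Carrier
  -1# = - 1#

  x+-1*x≈0 : ∀ x → x + -1# * x ≈ 0#
  x+-1*x≈0 x = trans (+-congˡ (-1*x≈-x x)) (-‿inverseʳ x)

  -1*-1≈1 : -1# * -1# ≈ 1#
  -1*-1≈1 = begin
    -1# * -1#                    ≈⟨ +-identityˡ _ ⟨
    0# + -1# * -1#               ≈⟨ +-congʳ (x+-1*x≈0 1#) ⟨
    1# + -1# * 1# + -1# * -1#    ≈⟨ +-assoc _ _ _ ⟩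
    1# + (-1# * 1# + -1# * -1#)  ≈⟨ +-congˡ (distribˡ _ _ _) ⟨
    1# + -1# * (1# + -1#)        ≈⟨ +-congˡ (*-congˡ (-‿inverseʳ 1#)) ⟩
    1# + -1# * 0#                ≈⟨ +-congˡ (zeroʳ _) ⟩
    1# + 0#                      ≈⟨ +-identityʳ _ ⟩
    1#                           ∎

  x≈y+z⇒y≈x-z : ∀ {x y z} → x ≈ y + z → y ≈ x + -1# * z
  x≈y+z⇒y≈x-z {x} {y} {z} x≈y+z = begin
    y                    ≈⟨ +-identityʳ y ⟨
    y + 0#               ≈⟨ +-congˡ (x+-1*x≈0 z) ⟨
    y + (z + -1# * z)    ≈⟨ +-assoc _ _ _ ⟨
    y + z + -1# * z      ≈⟨ +-congʳ x≈y+z ⟨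
    x + -1# * z          ∎

  inv-inverseʳ : ∀ {x} (x#0 : x # 0#) → x * inv x x#0 ≈ 1#
  inv-inverseʳ x#0 = trans (*-comm _ _) (inv-inverseˡ x#0)

  *-cancelˡ-#0 : ∀ {x y z} → x # 0# → x * y ≈ x * z → y ≈ z
  *-cancelˡ-#0 {x} {y} {z} x#0 xy≈xz = begin
    y                      ≈⟨ *-identityˡ y ⟨
    1# * y                 ≈⟨ *-congʳ (inv-inverseˡ x#0) ⟨
    inv x x#0 * x * y      ≈⟨ *-assoc _ _ _ ⟩
    inv x x#0 * (x * y)    ≈⟨ *-congˡ xy≈xz ⟩
    inv x x#0 * (x * z)    ≈⟨ *-assoc _ _ _ ⟨
    inv x x#0 * x * z      ≈⟨ *-congʳ (inv-inverseˡ x#0) ⟩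
    1# * z                 ≈⟨ *-identityˡ z ⟩
    z                      ∎

  -- `inv` takes an apartness proof, so congruence does not compare two inverses. This lemma does,
  -- and it identifies the inverses of products of q-factorials.
  inv-unique : ∀ {x y} (x#0 : x # 0#) → x * y ≈ 1# → y ≈ inv x x#0
  inv-unique x#0 xy≈1 = *-cancelˡ-#0 x#0 (trans xy≈1 (sym (inv-inverseʳ x#0)))

  -- Exponent laws for integer multiples and integer powers.

  fromℤ-suc : ∀ z → fromℤ (ℤ.suc z) ≈ 1# + fromℤ z
  fromℤ-suc (+ n)        = refl
  fromℤ-suc -[1+ zero ]  =
    sym (trans (+-congˡ (-‿cong (+-identityʳ 1#))) (-‿inverseʳ 1#))
  fromℤ-suc -[1+ suc n ] = begin
    fromℤ -[1+ n ]                         ≈⟨ -1*x≈-x _ ⟨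
    -1# * fromℤ (+ suc n)                  ≈⟨ +-identityˡ _ ⟨
    0# + -1# * fromℤ (+ suc n)             ≈⟨ +-congʳ (x+-1*x≈0 1#) ⟨
    1# + -1# * 1# + -1# * fromℤ (+ suc n)  ≈⟨ solve 3 (λ a b d → d :+ a :* d :+ a :* b := d :+ a :* (d :+ b)) refl -1# _ 1# ⟩
    1# + -1# * fromℤ (+ suc (suc n))       ≈⟨ +-congˡ (-1*x≈-x _) ⟩
    1# + fromℤ -[1+ suc n ]                ∎

  fromℤ-+ : ∀ x y → fromℤ (x ℤ.+ y) ≈ fromℤ x + fromℤ y
  fromℤ-+ = ℤ-Power.homo +-monoid 1# -1# (-‿inverseˡ 1#) fromℤ refl fromℤ-suc

  fromℤ-* : ∀ n z → fromℤ (+ n ℤ.* z) ≈ fromℤ (+ n) * fromℤ z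
  fromℤ-* zero    z = sym (zeroˡ _)
  fromℤ-* (suc n) z = begin
    fromℤ (+ suc n ℤ.* z)                ≡⟨ ≡.cong fromℤ (ℤₚ.suc-* (+ n) z) ⟩
    fromℤ (z ℤ.+ + n ℤ.* z)              ≈⟨ fromℤ-+ z (+ n ℤ.* z) ⟩
    fromℤ z + fromℤ (+ n ℤ.* z)          ≈⟨ +-congˡ (fromℤ-* n z) ⟩
    fromℤ z + fromℤ (+ n) * fromℤ z      ≈⟨ +-congʳ (*-identityˡ _) ⟨
    1# * fromℤ z + fromℤ (+ n) * fromℤ z ≈⟨ distribʳ _ _ _ ⟨
    fromℤ (+ suc n) * fromℤ z            ∎

  ^ℤ-suc : ∀ q z → q ^ℤ ℤ.suc z ≈ value q * q ^ℤ z
  ^ℤ-suc q (+ n)        = refl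
  ^ℤ-suc q -[1+ zero ]  =
    sym (trans (*-congˡ (*-identityʳ _)) (inv-inverseʳ (nonzero q)))
  ^ℤ-suc q -[1+ suc n ] = begin
    q ^ℤ -[1+ n ]                                             ≈⟨ *-identityˡ _ ⟨
    1# * q ^ℤ -[1+ n ]                                        ≈⟨ *-congʳ (inv-inverseʳ (nonzero q)) ⟨
    value q * inv (value q) (nonzero q) * q ^ℤ -[1+ n ]       ≈⟨ *-assoc _ _ _ ⟩
    value q * q ^ℤ -[1+ suc n ]                               ∎

  ^ℤ-+ : ∀ q x y → q ^ℤ (x ℤ.+ y) ≈ q ^ℤ x * q ^ℤ y
  ^ℤ-+ q = ℤ-Power.homo *-monoid (value q) (inv (value q) (nonzero q))
                        (inv-inverseˡ (nonzero q)) (q ^ℤ_) refl (^ℤ-suc q)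

  ^ℤ-* : ∀ q n z → q ^ℤ (+ n ℤ.* z) ≈ (q ^ℤ z) ^ n
  ^ℤ-* q zero    z = refl
  ^ℤ-* q (suc n) z = begin
    q ^ℤ (+ suc n ℤ.* z)     ≡⟨ ≡.cong (q ^ℤ_) (ℤₚ.suc-* (+ n) z) ⟩
    q ^ℤ (z ℤ.+ + n ℤ.* z)   ≈⟨ ^ℤ-+ q z (+ n ℤ.* z) ⟩
    q ^ℤ z * q ^ℤ (+ n ℤ.* z) ≈⟨ *-congˡ (^ℤ-* q n z) ⟩
    (q ^ℤ z) ^ suc n         ∎

  -- Arithmetic of q-numbers.

  -- For q = 1 the power is 1 and this is additivity of `fromℤ`; otherwise it is XY - 1 = (X - 1) +
  -- X(Y - 1), divided by q - 1.
  []-+ : ∀ q x y → [ x ℤ.+ y ]⟨ q ⟩ ≈ [ x ]⟨ q ⟩ + q ^ℤ x * [ y ]⟨ q ⟩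
  []-+ q x y with one-or-nonroot q
  ... | inj₁ q≈1 = begin
    fromℤ (x ℤ.+ y)             ≈⟨ fromℤ-+ x y ⟩
    fromℤ x + fromℤ y           ≈⟨ +-congˡ (*-identityˡ _) ⟨
    fromℤ x + 1# * fromℤ y      ≈⟨ +-congˡ (*-congʳ (^ℤ-≈1 q x q≈1)) ⟨
    fromℤ x + q ^ℤ x * fromℤ y  ∎
  ... | inj₂ r = begin
    (q ^ℤ (x ℤ.+ y) - 1#) * i                         ≈⟨ *-congʳ (+-congʳ (^ℤ-+ q x y)) ⟩
    (X * Y + -1#) * i                                 ≈⟨ *-congʳ (+-congʳ (+-identityˡ _)) ⟨
    (0# + X * Y + -1#) * i                            ≈⟨ *-congʳ (+-congʳ (+-congʳ (x+-1*x≈0 X))) ⟨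
    (X + -1# * X + X * Y + -1#) * i                   ≈⟨ solve 4 (λ X Y i ν → (X :+ ν :* X :+ X :* Y :+ ν) :* i :=
                                                          (X :+ ν) :* i :+ X :* ((Y :+ ν) :* i)) refl X Y i -1# ⟩
    (X + -1#) * i + X * ((Y + -1#) * i)               ∎
    where
    X = q ^ℤ x
    Y = q ^ℤ y
    i = inv (value q - 1#) (nonroot⇒-1#0 r)

  [0]≈0 : ∀ q → [ 0ℤ ]⟨ q ⟩ ≈ 0#
  [0]≈0 q with one-or-nonroot q
  ... | inj₁ _ = refl
  ... | inj₂ _ = trans (*-congʳ (-‿inverseʳ 1#)) (zeroˡ _)

  [1]≈1 : ∀ q → [ 1ℤ ]⟨ q ⟩ ≈ 1#
  [1]≈1 q with one-or-nonroot q
  ... | inj₁ _ = +-identityʳ 1#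
  ... | inj₂ r = trans (*-congʳ (+-congʳ (*-identityʳ _))) (inv-inverseʳ (nonroot⇒-1#0 r))

  -- Induction on `m` through `[]-+` treats all parameters alike. A case split would have to follow
  -- `q` and `q ^ᴾ z` separately: for `z = 0` the latter counts as 1 even if `q` is not a root of
  -- unity.
  [z]*[m]≈[z*m] : ∀ q z m → [ z ]⟨ q ⟩ * [ + m ]⟨ q ^ᴾ z ⟩ ≈ [ z ℤ.* + m ]⟨ q ⟩
  [z]*[m]≈[z*m] q z zero = begin
    [ z ]⟨ q ⟩ * [ 0ℤ ]⟨ q ^ᴾ z ⟩  ≈⟨ *-congˡ ([0]≈0 (q ^ᴾ z)) ⟩
    [ z ]⟨ q ⟩ * 0#                ≈⟨ zeroʳ _ ⟩
    0#                             ≈⟨ [0]≈0 q ⟨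
    [ 0ℤ ]⟨ q ⟩                    ≡⟨ ≡.cong [_]⟨ q ⟩ (ℤₚ.*-zeroʳ z) ⟨
    [ z ℤ.* 0ℤ ]⟨ q ⟩              ∎
  [z]*[m]≈[z*m] q z (suc m) = begin
    [z] * [ 1ℤ ℤ.+ + m ]⟨ p ⟩                          ≈⟨ *-congˡ ([]-+ p 1ℤ (+ m)) ⟩
    [z] * ([ 1ℤ ]⟨ p ⟩ + value p * 1# * [ + m ]⟨ p ⟩)  ≈⟨ *-congˡ (+-cong ([1]≈1 p) (*-congʳ (*-identityʳ _))) ⟩
    [z] * (1# + value p * [ + m ]⟨ p ⟩)                ≈⟨ distribˡ _ _ _ ⟩
    [z] * 1# + [z] * (value p * [ + m ]⟨ p ⟩)          ≈⟨ +-cong (*-identityʳ _) (solve 3 (λ a b d → a :* (b :* d) := b :* (a :* d)) refl _ _ _) ⟩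
    [z] + value p * ([z] * [ + m ]⟨ p ⟩)               ≈⟨ +-congˡ (*-congˡ ([z]*[m]≈[z*m] q z m)) ⟩
    [z] + q ^ℤ z * [ z ℤ.* + m ]⟨ q ⟩                  ≈⟨ []-+ q z (z ℤ.* + m) ⟨
    [ z ℤ.+ z ℤ.* + m ]⟨ q ⟩                           ≡⟨ ≡.cong [_]⟨ q ⟩ (ℤₚ.*-suc z (+ m)) ⟨
    [ z ℤ.* + suc m ]⟨ q ⟩                             ∎
    where
    p = q ^ᴾ z
    [z] = [ z ]⟨ q ⟩

  -- For q = 1 this is s(j/s + i) = j + si; otherwise the numerator of [s]_q cancels the denominator
  -- q^s - 1. Matching on the last field of the parameter and on `s` lets the branches for `q` and
  -- `q ^ᴾ + s` reduce together.
  [s]*fractional : ∀ q s (s≢0 : s ≢ 0) j i →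
                   [ + s ]⟨ q ⟩ * fractionalQNumber q s s≢0 j i ≈ [ j ℤ.+ + s ℤ.* i ]⟨ q ⟩
  [s]*fractional q                            zero    s≢0 j i with () ← s≢0 ≡.refl
  [s]*fractional (parameter _ _ (inj₁ _)) s@(suc _) s≢0 j i = begin
    σ * (fromℤ j * inv σ σ#0 + fromℤ i)        ≈⟨ solve 4 (λ σ j i′ i → σ :* (j :* i′ :+ i) := (i′ :* σ) :* j :+ σ :* i) refl _ _ _ _ ⟩
    inv σ σ#0 * σ * fromℤ j + σ * fromℤ i      ≈⟨ +-cong (*-congʳ (inv-inverseˡ σ#0)) (sym (fromℤ-* s i)) ⟩
    1# * fromℤ j + fromℤ (+ s ℤ.* i)           ≈⟨ +-congʳ (*-identityˡ _) ⟩
    fromℤ j + fromℤ (+ s ℤ.* i)                ≈⟨ fromℤ-+ j (+ s ℤ.* i) ⟨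
    fromℤ (j ℤ.+ + s ℤ.* i)                    ∎
    where
    σ = fromℤ (+ s)
    σ#0 = fromℤ-#0 (+≢0 s≢0)
  [s]*fractional (parameter q₀ _ (inj₂ r)) (suc m) s≢0 j i = begin
    (Q * i₁) * (X * i₂)   ≈⟨ solve 4 (λ Q i₁ X i₂ → (Q :* i₁) :* (X :* i₂) := (i₂ :* Q) :* (X :* i₁)) refl Q i₁ X i₂ ⟩
    (i₂ * Q) * (X * i₁)   ≈⟨ *-congʳ (inv-inverseˡ _) ⟩
    1# * (X * i₁)         ≈⟨ *-identityˡ _ ⟩
    X * i₁                ∎
    where
    Q = q₀ ^ suc m - 1#
    X = parameter q₀ _ (inj₂ r) ^ℤ (j ℤ.+ + suc m ℤ.* i) - 1#
    i₁ = inv (q₀ - 1#) (nonroot⇒-1#0 r)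
    i₂ = inv Q (nonroot⇒-1#0 (^-nonroot m r))

  -- Sums over the pairs m + j = k.

  -- The summand takes both indices, so either can be shifted without truncated subtraction; summing
  -- over `j` matches the order of the sums in the theorem.
  antidiagonal : (ℕ → ℕ → Carrier) → ℕ → Carrier
  antidiagonal φ k = ∑[ j ≤ k ] φ (k ∸ toℕ j) (toℕ j)

  antidiagonal-cong : ∀ φ ψ k → (∀ m j → m ℕ.+ j ≡ k → φ m j ≈ ψ m j) →
                      antidiagonal φ k ≈ antidiagonal ψ k
  antidiagonal-cong φ ψ k φ≈ψ =
    sum-cong-≋ {suc k} (λ j → φ≈ψ (k ∸ toℕ j) (toℕ j) (ℕₚ.m∸n+n≡m (toℕ≤pred[n] j)))

  -- The term with m = 0 stands last in the sum, hence the induction; the term with j = 0 stands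
  -- first.
  antidiagonal-dropˡ : ∀ φ k → (∀ j → φ 0 j ≈ 0#) →
                       antidiagonal φ (suc k) ≈ antidiagonal (λ m → φ (suc m)) k
  antidiagonal-dropˡ φ zero    φ0≈0 = +-congˡ (trans (+-identityʳ _) (φ0≈0 1))
  antidiagonal-dropˡ φ (suc k) φ0≈0 =
    +-congˡ (antidiagonal-dropˡ (λ m j → φ m (suc j)) k (λ j → φ0≈0 (suc j)))

  antidiagonal-dropʳ : ∀ φ k → (∀ m → φ m 0 ≈ 0#) →
                       antidiagonal φ (suc k) ≈ antidiagonal (λ m j → φ m (suc j)) k
  antidiagonal-dropʳ φ k φ0≈0 = trans (+-congʳ (φ0≈0 (suc k))) (+-identityˡ _)

  antidiagonal-+ : ∀ φ ψ k → antidiagonal (λ m j → φ m j + ψ m j) k ≈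
                             antidiagonal φ k + antidiagonal ψ k
  antidiagonal-+ φ ψ k = ∑-distrib-+ {suc k} (λ j → φ (k ∸ toℕ j) (toℕ j)) (λ j → ψ (k ∸ toℕ j) (toℕ j))

  antidiagonal-* : ∀ a φ k → a * antidiagonal φ k ≈ antidiagonal (λ m j → a * φ m j) k
  antidiagonal-* a φ k = *-distribˡ-sum {suc k} a (λ j → φ (k ∸ toℕ j) (toℕ j))

  -- A case of the q-binomial theorem.

  module _ (p : Parameter) where

    1/!  : ℕ → Carrier
    1/! n = inv [ n ]!⟨ p ⟩ ([]!-#0 n p)

    -- With e(z) the q-exponential series whose coefficients are `1/!`, these are the coefficients
    -- of its inverse 1/e(z).
    u : ℕ → Carrier
    u m = -1# ^ m * value p ^ (m C 2) * 1/! m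

    1/!-suc : ∀ n → [ + suc n ]⟨ p ⟩ * 1/! (suc n) ≈ 1/! n
    1/!-suc n = inv-unique ([]!-#0 n p)
      (trans (solve 3 (λ a b d → a :* (b :* d) := b :* a :* d) refl _ _ _)
             (inv-inverseʳ ([]!-#0 (suc n) p)))

    -- The power p^m comes from C(m+1,2) = m + C(m,2), and [m+1]_p cancels against the factorial.
    u-suc : ∀ m → [ + suc m ]⟨ p ⟩ * u (suc m) ≈ -1# * value p ^ m * u m
    u-suc m = begin
      [m+1] * (-1# * -1# ^ m * value p ^ (suc m C 2) * 1/! (suc m))          ≡⟨ ≡.cong (λ b → [m+1] * (-1# * -1# ^ m * value p ^ b * 1/! (suc m))) C₂-suc ⟩
      [m+1] * (-1# * -1# ^ m * value p ^ (m ℕ.+ m C 2) * 1/! (suc m))        ≈⟨ *-congˡ (*-congʳ (*-congˡ (^-homo-* (value p) m (m C 2)))) ⟩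
      [m+1] * (-1# * -1# ^ m * (value p ^ m * value p ^ (m C 2)) * 1/! (suc m))
        ≈⟨ solve 6 (λ a ν s x y i → a :* (ν :* s :* (x :* y) :* i) := ν :* x :* (s :* y :* (a :* i))) refl _ _ _ _ _ _ ⟩
      -1# * value p ^ m * (-1# ^ m * value p ^ (m C 2) * ([m+1] * 1/! (suc m)))
        ≈⟨ *-congˡ (*-congˡ (1/!-suc m)) ⟩
      -1# * value p ^ m * u m                                                ∎
      where
      [m+1] = [ + suc m ]⟨ p ⟩
      C₂-suc : suc m C 2 ≡ m ℕ.+ m C 2
      C₂-suc = ≡.trans (≡.sym (nCk+nC[k+1]≡[n+1]C[k+1] m 1)) (≡.cong (ℕ._+ m C 2) (nC1≡n m))

    qBinomial≈ : ∀ k j → qBinomial p k j ≈ [ k ]!⟨ p ⟩ * (1/! j * 1/! (k ∸ j))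
    qBinomial≈ k j = *-congˡ (sym (inv-unique _ (begin
      a * b * (1/! j * 1/! (k ∸ j))     ≈⟨ solve 4 (λ a b x y → a :* b :* (x :* y) := (a :* x) :* (b :* y)) refl _ _ _ _ ⟩
      (a * 1/! j) * (b * 1/! (k ∸ j))   ≈⟨ *-cong (inv-inverseʳ ([]!-#0 j p)) (inv-inverseʳ ([]!-#0 (k ∸ j) p)) ⟩
      1# * 1#                           ≈⟨ *-identityˡ 1# ⟩
      1#                                ∎)))
      where
      a = [ j ]!⟨ p ⟩
      b = [ k ∸ j ]!⟨ p ⟩

    -- Splitting [k]_p as [j]_p + p^j [m]_p gives each summand the factor with which `1/!-suc` or
    -- `u-suc` lowers one index.
    [k]*[u*1/!] : ∀ k m j → m ℕ.+ j ≡ k →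
                  [ + k ]⟨ p ⟩ * (u m * 1/! j) ≈
                  u m * ([ + j ]⟨ p ⟩ * 1/! j) + value p ^ j * ([ + m ]⟨ p ⟩ * u m) * 1/! j
    [k]*[u*1/!] k m j ≡.refl = begin
      [ + (m ℕ.+ j) ]⟨ p ⟩ * (u m * 1/! j)      ≡⟨ ≡.cong (λ i → [ + i ]⟨ p ⟩ * (u m * 1/! j)) (ℕₚ.+-comm m j) ⟩
      [ + j ℤ.+ + m ]⟨ p ⟩ * (u m * 1/! j)      ≈⟨ *-congʳ ([]-+ p (+ j) (+ m)) ⟩
      ([ + j ]⟨ p ⟩ + value p ^ j * [ + m ]⟨ p ⟩) * (u m * 1/! j)
        ≈⟨ solve 5 (λ a x b u v → (a :+ x :* b) :* (u :* v) := u :* (a :* v) :+ x :* (b :* u) :* v) refl _ _ _ _ _ ⟩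
      u m * ([ + j ]⟨ p ⟩ * 1/! j) + value p ^ j * ([ + m ]⟨ p ⟩ * u m) * 1/! j ∎

    -- [k+1]_p = [j]_p + p^j [m]_p for m + j = k + 1 gives
    -- [k+1]_p G(k+1) = (1 - p^k) G(k), and the factor for k = 0 vanishes.
    alternating-sum : ∀ k → antidiagonal (λ m j → u m * 1/! j) (suc k) ≈ 0#
    alternating-sum k = *-cancelˡ-#0 ([]-#0 p {+ suc k} (λ ())) (trans [k+1]G (trans (vanish k) (sym (zeroʳ _))))
      where
      g : ℕ → ℕ → Carrier
      g m j = u m * 1/! j

      G : ℕ → Carrier
      G = antidiagonal g

      [k+1]G : ∀ {k} → [ + suc k ]⟨ p ⟩ * G (suc k) ≈ G k + -1# * value p ^ k * G k
      [k+1]G {k} = begin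
        [ + suc k ]⟨ p ⟩ * G (suc k)
          ≈⟨ antidiagonal-* _ g (suc k) ⟩
        antidiagonal (λ m j → [ + suc k ]⟨ p ⟩ * g m j) (suc k)
          ≈⟨ antidiagonal-cong (λ m j → [ + suc k ]⟨ p ⟩ * g m j) (λ m j → φ m j + ψ m j) (suc k) ([k]*[u*1/!] (suc k)) ⟩
        antidiagonal (λ m j → φ m j + ψ m j) (suc k)
          ≈⟨ antidiagonal-+ φ ψ (suc k) ⟩
        antidiagonal φ (suc k) + antidiagonal ψ (suc k)
          -- The boundary terms, j = 0 in `φ` and m = 0 in `ψ`, contain [0]_p = 0.
          ≈⟨ +-cong (antidiagonal-dropʳ φ k (λ m → trans (*-congˡ (trans (*-congʳ ([0]≈0 p)) (zeroˡ _))) (zeroʳ _)))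
                    (antidiagonal-dropˡ ψ k (λ j → trans (*-congʳ (trans (*-congˡ (trans (*-congʳ ([0]≈0 p)) (zeroˡ _))) (zeroʳ _))) (zeroˡ _))) ⟩
        antidiagonal (λ m j → φ m (suc j)) k + antidiagonal (λ m → ψ (suc m)) k
          ≈⟨ +-cong (antidiagonal-cong (λ m j → φ m (suc j)) g k (λ m j _ → *-congˡ (1/!-suc j)))
                    (antidiagonal-cong (λ m → ψ (suc m)) (λ m j → -1# * value p ^ k * g m j) k ψ-suc) ⟩
        G k + antidiagonal (λ m j → -1# * value p ^ k * g m j) k
          ≈⟨ +-congˡ (antidiagonal-* _ g k) ⟨
        G k + -1# * value p ^ k * G k ∎
        where
        φ ψ : ℕ → ℕ → Carrier
        φ m j = u m * ([ + j ]⟨ p ⟩ * 1/! j)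
        ψ m j = value p ^ j * ([ + m ]⟨ p ⟩ * u m) * 1/! j

        -- The power p^j p^m = p^k is constant on the antidiagonal and so can leave the sum.
        ψ-suc : ∀ m j → m ℕ.+ j ≡ k → ψ (suc m) j ≈ -1# * value p ^ k * (u m * 1/! j)
        ψ-suc m j ≡.refl = begin
          value p ^ j * ([ + suc m ]⟨ p ⟩ * u (suc m)) * 1/! j   ≈⟨ *-congʳ (*-congˡ (u-suc m)) ⟩
          value p ^ j * (-1# * value p ^ m * u m) * 1/! j
            ≈⟨ solve 5 (λ x ν y u v → x :* (ν :* y :* u) :* v := ν :* (y :* x) :* (u :* v)) refl _ _ _ _ _ ⟩
          -1# * (value p ^ m * value p ^ j) * (u m * 1/! j)      ≈⟨ *-congʳ (*-congˡ (^-homo-* (value p) m j)) ⟨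
          -1# * value p ^ (m ℕ.+ j) * (u m * 1/! j)              ∎

      vanish : ∀ k → G k + -1# * value p ^ k * G k ≈ 0#
      vanish zero    = trans (+-congˡ (*-congʳ (*-identityʳ -1#))) (x+-1*x≈0 _)
      -- Here `G (suc k)` itself is zero, by the lemma for the smaller index.
      vanish (suc k) = begin
        G (suc k) + -1# * value p ^ suc k * G (suc k)  ≈⟨ +-cong (alternating-sum k) (*-congˡ (alternating-sum k)) ⟩
        0# + -1# * value p ^ suc k * 0#                ≈⟨ +-identityˡ _ ⟩
        -1# * value p ^ suc k * 0#                     ≈⟨ zeroʳ _ ⟩
        0#                                             ∎

  -- The recurrence of F and its comparison with S.

  -- p is not defined as q ^ᴾ (1 - s) because the formula for s = 0 is stated
  -- with q itself in its place.
  module Closed (s : ℕ) (h : Carrier) (q p : Parameter)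
                (p≈ : value p ≈ q ^ℤ (1ℤ ℤ.- + s))
                ([]-p : ∀ m → [ 1ℤ ℤ.- + s ]⟨ q ⟩ * [ + m ]⟨ p ⟩ ≈ [ (1ℤ ℤ.- + s) ℤ.* + m ]⟨ q ⟩)
                where

    x : ℕ → ℕ → ℤ
    x n k = + s ℤ.* + n ℤ.- (+ s ℤ.- 1ℤ) ℤ.* + k

    x-+ : ∀ n m j → x n (m ℕ.+ j) ≡ x n j ℤ.+ (1ℤ ℤ.- + s) ℤ.* + m
    x-+ n m j = identity (+ s) (+ n) (+ m) (+ j)
      where
      identity : ∀ s n m j → s ℤ.* n ℤ.- (s ℤ.- 1ℤ) ℤ.* (m ℤ.+ j) ≡
                             (s ℤ.* n ℤ.- (s ℤ.- 1ℤ) ℤ.* j) ℤ.+ (1ℤ ℤ.- s) ℤ.* m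
      identity = ℤ-Solver.solve-∀

    δ : Carrier
    δ = [ 1ℤ ℤ.- + s ]⟨ q ⟩

    P : ℕ → ℕ → Carrier
    P zero    j = 1#
    P (suc n) j = P n j * [ x n j ]⟨ q ⟩

    F : ℕ → ℕ → Carrier
    F n = antidiagonal (λ m j → u p m * 1/! p j * P n j)

    F-zero-zero : F 0 0 ≈ 1#
    F-zero-zero = begin
      1# * 1# * 1/! p 0 * 1/! p 0 * 1# + 0#   ≈⟨ +-identityʳ _ ⟩
      1# * 1# * 1/! p 0 * 1/! p 0 * 1#        ≈⟨ *-identityʳ _ ⟩
      1# * 1# * 1/! p 0 * 1/! p 0             ≈⟨ *-cong (*-cong (*-identityˡ 1#) 1/!0≈1) 1/!0≈1 ⟩
      1# * 1# * 1#                            ≈⟨ *-identityʳ _ ⟩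
      1# * 1#                                 ≈⟨ *-identityʳ _ ⟩
      1#                                      ∎
      where
      1/!0≈1 : 1/! p 0 ≈ 1#
      1/!0≈1 = sym (inv-unique _ (*-identityˡ 1#))

    F-zero-suc : ∀ k → F 0 (suc k) ≈ 0#
    F-zero-suc k = trans
      (antidiagonal-cong (λ m j → u p m * 1/! p j * 1#) (λ m j → u p m * 1/! p j) (suc k)
                         (λ m j _ → *-identityʳ _))
      (alternating-sum p k)

    -- The factor with index 0 is [x(0,0)]_q = [0]_q.
    P-zero : ∀ n → P (suc n) 0 ≈ 0#
    P-zero zero    = begin
      1# * [ x 0 0 ]⟨ q ⟩  ≡⟨ ≡.cong (λ z → 1# * [ z ]⟨ q ⟩) (identity (+ s)) ⟩
      1# * [ 0ℤ ]⟨ q ⟩     ≈⟨ *-congˡ ([0]≈0 q) ⟩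
      1# * 0#              ≈⟨ zeroʳ 1# ⟩
      0#                   ∎
      where
      identity : ∀ s → s ℤ.* 0ℤ ℤ.- (s ℤ.- 1ℤ) ℤ.* 0ℤ ≡ 0ℤ
      identity = ℤ-Solver.solve-∀
    P-zero (suc n) = trans (*-congʳ (P-zero n)) (zeroˡ _)

    F-suc-zero : ∀ n → F (suc n) 0 ≈ 0#
    F-suc-zero n = trans (+-identityʳ _) (trans (*-congˡ (P-zero n)) (zeroʳ _))

    F-suc-suc : ∀ n k → F (suc n) (suc k) ≈
                        [ x n (suc k) ]⟨ q ⟩ * F n (suc k) + δ * q ^ℤ x n k * F n k
    F-suc-suc n k = begin
      F (suc n) (suc k)
        ≈⟨ antidiagonal-cong (λ m j → u p m * 1/! p j * P (suc n) j) (λ m j → A * f m j + ψ m j) (suc k) split ⟩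
      antidiagonal (λ m j → A * f m j + ψ m j) (suc k)
        ≈⟨ antidiagonal-+ (λ m j → A * f m j) ψ (suc k) ⟩
      antidiagonal (λ m j → A * f m j) (suc k) + antidiagonal ψ (suc k)
        ≈⟨ +-cong (sym (antidiagonal-* A f (suc k))) (antidiagonal-dropˡ ψ k ψ-zero) ⟩
      A * F n (suc k) + antidiagonal (λ m → ψ (suc m)) k
        ≈⟨ +-congˡ (antidiagonal-cong (λ m → ψ (suc m)) (λ m j → δ * q ^ℤ x n k * f m j) k ψ-suc) ⟩
      A * F n (suc k) + antidiagonal (λ m j → δ * q ^ℤ x n k * f m j) k
        ≈⟨ +-congˡ (antidiagonal-* _ f k) ⟨
      A * F n (suc k) + δ * q ^ℤ x n k * F n k ∎
      where
      A = [ x n (suc k) ]⟨ q ⟩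

      -- `ψ` is what remains of a summand when [x(n,j)]_q is replaced by `A`, which is constant on
      -- the antidiagonal. Its factor [m]_p removes the term m = 0 and moves the sum down to the
      -- antidiagonal of `k`.
      f ψ : ℕ → ℕ → Carrier
      f m j = u p m * 1/! p j * P n j
      ψ m j = -1# * (q ^ℤ x n j * δ) * ([ + m ]⟨ p ⟩ * u p m) * (1/! p j * P n j)

      shift : ∀ m j → m ℕ.+ j ≡ suc k →
              [ x n j ]⟨ q ⟩ ≈ A + -1# * (q ^ℤ x n j * (δ * [ + m ]⟨ p ⟩))
      shift m j m+j≡k+1 = x≈y+z⇒y≈x-z (begin
        A                                                          ≡⟨ ≡.cong (λ i → [ x n i ]⟨ q ⟩) m+j≡k+1 ⟨
        [ x n (m ℕ.+ j) ]⟨ q ⟩                                     ≡⟨ ≡.cong [_]⟨ q ⟩ (x-+ n m j) ⟩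
        [ x n j ℤ.+ (1ℤ ℤ.- + s) ℤ.* + m ]⟨ q ⟩                    ≈⟨ []-+ q (x n j) _ ⟩
        [ x n j ]⟨ q ⟩ + q ^ℤ x n j * [ (1ℤ ℤ.- + s) ℤ.* + m ]⟨ q ⟩ ≈⟨ +-congˡ (*-congˡ ([]-p m)) ⟨
        [ x n j ]⟨ q ⟩ + q ^ℤ x n j * (δ * [ + m ]⟨ p ⟩)           ∎)

      split : ∀ m j → m ℕ.+ j ≡ suc k →
              u p m * 1/! p j * P (suc n) j ≈ A * f m j + ψ m j
      split m j m+j≡k+1 = begin
        u p m * 1/! p j * (P n j * [ x n j ]⟨ q ⟩)
          ≈⟨ *-congˡ (*-congˡ (shift m j m+j≡k+1)) ⟩
        u p m * 1/! p j * (P n j * (A + -1# * (q ^ℤ x n j * (δ * [ + m ]⟨ p ⟩))))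
          ≈⟨ solve 8 (λ u v P A ν e δ b → u :* v :* (P :* (A :+ ν :* (e :* (δ :* b)))) :=
                       A :* (u :* v :* P) :+ ν :* (e :* δ) :* (b :* u) :* (v :* P)) refl _ _ _ _ _ _ _ _ ⟩
        A * f m j + ψ m j ∎

      ψ-zero : ∀ j → ψ 0 j ≈ 0#
      ψ-zero j = trans (*-congʳ (trans (*-congˡ (trans (*-congʳ ([0]≈0 p)) (zeroˡ _))) (zeroʳ _))) (zeroˡ _)

      -- x(n,j) + (1-s)m = x(n,m+j), so this power too is constant on the antidiagonal.
      q^x : ∀ m j → m ℕ.+ j ≡ k → q ^ℤ x n j * value p ^ m ≈ q ^ℤ x n k
      q^x m j ≡.refl = begin
        q ^ℤ x n j * value p ^ m                       ≈⟨ *-congˡ (^-congˡ m p≈) ⟩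
        q ^ℤ x n j * (q ^ℤ (1ℤ ℤ.- + s)) ^ m           ≈⟨ *-congˡ (^ℤ-* q m _) ⟨
        q ^ℤ x n j * q ^ℤ (+ m ℤ.* (1ℤ ℤ.- + s))       ≡⟨ ≡.cong (λ z → q ^ℤ x n j * q ^ℤ z) (ℤₚ.*-comm (+ m) (1ℤ ℤ.- + s)) ⟩
        q ^ℤ x n j * q ^ℤ ((1ℤ ℤ.- + s) ℤ.* + m)       ≈⟨ ^ℤ-+ q (x n j) _ ⟨
        q ^ℤ (x n j ℤ.+ (1ℤ ℤ.- + s) ℤ.* + m)          ≡⟨ ≡.cong (q ^ℤ_) (x-+ n m j) ⟨
        q ^ℤ x n (m ℕ.+ j)                             ∎

      ψ-suc : ∀ m j → m ℕ.+ j ≡ k → ψ (suc m) j ≈ δ * q ^ℤ x n k * f m j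
      ψ-suc m j m+j≡k = begin
        -1# * (q ^ℤ x n j * δ) * ([ + suc m ]⟨ p ⟩ * u p (suc m)) * (1/! p j * P n j)
          ≈⟨ *-congʳ (*-congˡ (u-suc p m)) ⟩
        -1# * (q ^ℤ x n j * δ) * (-1# * value p ^ m * u p m) * (1/! p j * P n j)
          ≈⟨ solve 7 (λ ν e δ y u v P → ν :* (e :* δ) :* (ν :* y :* u) :* (v :* P) :=
                       (ν :* ν) :* (δ :* (e :* y) :* (u :* v :* P))) refl _ _ _ _ _ _ _ ⟩
        (-1# * -1#) * (δ * (q ^ℤ x n j * value p ^ m) * f m j)
          -- One sign comes from `shift`, the other from `u-suc`.
          ≈⟨ *-cong -1*-1≈1 (*-congʳ (*-congˡ (q^x m j m+j≡k))) ⟩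
        1# * (δ * q ^ℤ x n k * f m j)
          ≈⟨ *-identityˡ _ ⟩
        δ * q ^ℤ x n k * f m j ∎

    -- With h^k on the left in place of h^(n-k) on the right, the induction on `n` runs over all
    -- `k`, including k > n, free of truncated subtraction and of division by `h` or `δ`.
    h^k*δ^k*S : ∀ n k → h ^ k * δ ^ k * S s h q n k ≈ h ^ n * F n k
    h^k*δ^k*S zero zero =
      trans (*-identityʳ _) (*-congˡ (sym F-zero-zero))
    h^k*δ^k*S zero (suc k) =
      trans (zeroʳ _) (sym (trans (*-congˡ (F-zero-suc k)) (zeroʳ _)))
    h^k*δ^k*S (suc n) zero =
      trans (zeroʳ _) (sym (trans (*-congˡ (F-suc-zero n)) (zeroʳ _)))
    h^k*δ^k*S (suc n) (suc k) = begin
      h * h ^ k * (δ * δ ^ k) * (e * S s h q n k + h * A * S s h q n (suc k))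
        ≈⟨ solve 8 (λ h η δ d e S A T → h :* η :* (δ :* d) :* (e :* S :+ h :* A :* T) :=
                     h :* (A :* (h :* η :* (δ :* d) :* T) :+ δ :* e :* (η :* d :* S)))
             refl h (h ^ k) δ (δ ^ k) e (S s h q n k) A (S s h q n (suc k)) ⟩
      h * (A * (h ^ suc k * δ ^ suc k * S s h q n (suc k)) + δ * e * (h ^ k * δ ^ k * S s h q n k))
        ≈⟨ *-congˡ (+-cong (*-congˡ (h^k*δ^k*S n (suc k))) (*-congˡ (h^k*δ^k*S n k))) ⟩
      h * (A * (h ^ n * F n (suc k)) + δ * e * (h ^ n * F n k))
        ≈⟨ solve 7 (λ h η A F δ e G → h :* (A :* (η :* F) :+ δ :* e :* (η :* G)) :=
                     h :* η :* (A :* F :+ δ :* e :* G)) refl _ _ _ _ _ _ _ ⟩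
      h * h ^ n * (A * F n (suc k) + δ * e * F n k)
        ≈⟨ *-congˡ (F-suc-suc n k) ⟨
      h * h ^ n * F (suc n) (suc k) ∎
      where
      e = q ^ℤ x n k
      A = [ x n (suc k) ]⟨ q ⟩

    δ^k*S : h # 0# → ∀ {n k} → k ≤ n → δ ^ k * S s h q n k ≈ h ^ (n ∸ k) * F n k
    δ^k*S h#0 {n} {k} k≤n = *-cancelˡ-#0 (^-#0 k h#0) (begin
      h ^ k * (δ ^ k * S s h q n k)     ≈⟨ *-assoc _ _ _ ⟨
      h ^ k * δ ^ k * S s h q n k       ≈⟨ h^k*δ^k*S n k ⟩
      h ^ n * F n k                     ≡⟨ ≡.cong (λ i → h ^ i * F n k) (ℕₚ.m+[n∸m]≡n k≤n) ⟨
      h ^ (k ℕ.+ (n ∸ k)) * F n k       ≈⟨ *-congʳ (^-homo-* h k (n ∸ k)) ⟩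
      h ^ k * h ^ (n ∸ k) * F n k       ≈⟨ *-assoc _ _ _ ⟩
      h ^ k * (h ^ (n ∸ k) * F n k)     ∎)

    -- From F to the sums and quotients of the theorem.

    -- `Q` and `R` stand for the power of p and the last factor as each of the two formulas writes
    -- them; `c` is the constant that turns `R` into `P`, namely [s]_q^n or 1.
    binomial-sum : ∀ c n k {Q R : ℕ → Carrier} →
                   (∀ j → Q (k ∸ j) ≈ value p ^ ((k ∸ j) C 2)) → (∀ j → c * R j ≈ P n j) →
                   c * (∑[ j ≤ k ] (-1# ^ (k ∸ toℕ j) * Q (k ∸ toℕ j) * qBinomial p k (toℕ j) * R (toℕ j)))
                   ≈ [ k ]!⟨ p ⟩ * F n k
    binomial-sum c n k {Q} {R} Q≈ cR≈P = begin
      c * (∑[ j ≤ k ] t j)                             ≈⟨ *-distribˡ-sum {suc k} c t ⟩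
      ∑[ j ≤ k ] (c * t j)                             ≈⟨ sum-cong-≋ {suc k} (λ j → term (toℕ j)) ⟩
      antidiagonal (λ m j → [ k ]!⟨ p ⟩ * f m j) k     ≈⟨ antidiagonal-* _ f k ⟨
      [ k ]!⟨ p ⟩ * F n k                              ∎
      where
      f : ℕ → ℕ → Carrier
      f m j = u p m * 1/! p j * P n j
      t : Fin (suc k) → Carrier
      t j = -1# ^ (k ∸ toℕ j) * Q (k ∸ toℕ j) * qBinomial p k (toℕ j) * R (toℕ j)
      term : ∀ j → c * (-1# ^ (k ∸ j) * Q (k ∸ j) * qBinomial p k j * R j) ≈
                   [ k ]!⟨ p ⟩ * f (k ∸ j) j
      term j = begin
        c * (-1# ^ (k ∸ j) * Q (k ∸ j) * qBinomial p k j * R j)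
          ≈⟨ *-congˡ (*-congʳ (*-cong (*-congˡ (Q≈ j)) (qBinomial≈ p k j))) ⟩
        c * (-1# ^ (k ∸ j) * value p ^ ((k ∸ j) C 2) * ([ k ]!⟨ p ⟩ * (1/! p j * 1/! p (k ∸ j))) * R j)
          ≈⟨ solve 7 (λ c ν Q a v w R → c :* (ν :* Q :* (a :* (v :* w)) :* R) :=
                       a :* (ν :* Q :* w :* v :* (c :* R))) refl _ _ _ _ _ _ _ ⟩
        [ k ]!⟨ p ⟩ * (u p (k ∸ j) * 1/! p j * (c * R j))
          ≈⟨ *-congˡ (*-congˡ (cR≈P j)) ⟩
        [ k ]!⟨ p ⟩ * f (k ∸ j) j ∎

    -- `a` and `d` are the numerator and denominator as written in a formula, with any apartness
    -- proof for `d`. Both [k]_p! and `c` cancel between the prefactor and the sum.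
    S≈quotient : h # 0# → ∀ {n k} → k ≤ n → ∀ {a c d Σ} (d#0 : d # 0#) →
                 a ≈ h ^ (n ∸ k) * c → d ≈ [ k ]!⟨ p ⟩ * δ ^ k →
                 c * Σ ≈ [ k ]!⟨ p ⟩ * F n k →
                 S s h q n k ≈ a / d [ d#0 ] * Σ
    S≈quotient h#0 {n} {k} k≤n {a} {c} {d} {Σ} d#0 a≈ d≈ cΣ≈ = sym (begin
      a * inv d d#0 * Σ                                 ≈⟨ *-congʳ (*-congʳ a≈) ⟩
      h ^ (n ∸ k) * c * inv d d#0 * Σ                   ≈⟨ solve 4 (λ η c i t → η :* c :* i :* t := i :* η :* (c :* t)) refl _ _ _ _ ⟩
      inv d d#0 * h ^ (n ∸ k) * (c * Σ)                 ≈⟨ *-congˡ cΣ≈ ⟩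
      inv d d#0 * h ^ (n ∸ k) * ([ k ]!⟨ p ⟩ * F n k)   ≈⟨ solve 4 (λ i η b t → i :* η :* (b :* t) := i :* b :* (η :* t)) refl _ _ _ _ ⟩
      inv d d#0 * [ k ]!⟨ p ⟩ * (h ^ (n ∸ k) * F n k)   ≈⟨ *-congˡ (δ^k*S h#0 k≤n) ⟨
      inv d d#0 * [ k ]!⟨ p ⟩ * (δ ^ k * S s h q n k)   ≈⟨ solve 4 (λ i b δ t → i :* b :* (δ :* t) := i :* (b :* δ) :* t) refl _ _ _ _ ⟩
      inv d d#0 * ([ k ]!⟨ p ⟩ * δ ^ k) * S s h q n k   ≈⟨ *-congʳ (*-congˡ d≈) ⟨
      inv d d#0 * d * S s h q n k                       ≈⟨ *-congʳ (inv-inverseˡ d#0) ⟩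
      1# * S s h q n k                                  ≈⟨ *-identityˡ _ ⟩
      S s h q n k                                       ∎)

    module _ (s≢0 : s ≢ 0) where

      -- `i` counts from 0, so t = i + 1 in [j/s + t - j - 1].
      fractional : ℕ → ℕ → Carrier
      fractional j i = fractionalQNumber q s s≢0 (+ j) (+ suc i ℤ.- + j ℤ.- 1ℤ)

      -- With t = i + 1, j + s(t - j - 1) = si - (s-1)j.
      [s]*fractional≈[x] : ∀ j i → [ + s ]⟨ q ⟩ * fractional j i ≈ [ x i j ]⟨ q ⟩
      [s]*fractional≈[x] j i = trans ([s]*fractional q s s≢0 (+ j) _)
                                     (reflexive (≡.cong [_]⟨ q ⟩ (identity (+ s) (+ j) (+ i))))
        where
        identity : ∀ s j i → j ℤ.+ s ℤ.* (1ℤ ℤ.+ i ℤ.- j ℤ.- 1ℤ) ≡ s ℤ.* i ℤ.- (s ℤ.- 1ℤ) ℤ.* j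
        identity = ℤ-Solver.solve-∀

      [s]^n*∏≈P : ∀ n j → [ + s ]⟨ q ⟩ ^ n * (∏[ i < n ] fractional j (toℕ i)) ≈ P n j
      [s]^n*∏≈P zero    j = *-identityˡ 1#
      [s]^n*∏≈P (suc n) j = begin
        σ * σ ^ n * (∏[ i < suc n ] fractional j (toℕ i))
          -- `product` unfolds at its first factor but `P` at its last.
          ≈⟨ *-congˡ (∏.sum-init-last {n} (λ i → fractional j (toℕ i))) ⟩
        σ * σ ^ n * ((∏[ i < n ] fractional j (toℕ (Fin.inject₁ i))) * fractional j (toℕ (Fin.fromℕ n)))
          ≈⟨ *-congˡ (*-cong (∏.sum-cong-≋ {n} (λ i → reflexive (≡.cong (fractional j) (toℕ-inject₁ i))))
                             (reflexive (≡.cong (fractional j) (toℕ-fromℕ n)))) ⟩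
        σ * σ ^ n * ((∏[ i < n ] fractional j (toℕ i)) * fractional j n)
          ≈⟨ solve 4 (λ a b t c → a :* b :* (t :* c) := b :* t :* (a :* c)) refl _ _ _ _ ⟩
        σ ^ n * (∏[ i < n ] fractional j (toℕ i)) * (σ * fractional j n)
          ≈⟨ *-cong ([s]^n*∏≈P n j) ([s]*fractional≈[x] j n) ⟩
        P n j * [ x n j ]⟨ q ⟩ ∎
        where
        σ = [ + s ]⟨ q ⟩

  -- The two choices of p.

  module AtPower (s : ℕ) (h : Carrier) (q : Parameter) where
    open Closed s h q (q ^ᴾ (1ℤ ℤ.- + s)) refl ([z]*[m]≈[z*m] q (1ℤ ℤ.- + s)) public

  module AtZero (h : Carrier) (q : Parameter) where
    open Closed 0 h q q (sym (*-identityʳ _))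
      (λ m → trans (*-congʳ ([1]≈1 q))
            (trans (*-identityˡ _) (reflexive (≡.cong [_]⟨ q ⟩ (≡.sym (ℤₚ.*-identityˡ (+ m)))))))
      public

    -- For s = 0, `δ` is [1]_q = 1.
    [k]!≈[k]!*δ^k : ∀ k → [ k ]!⟨ q ⟩ ≈ [ k ]!⟨ q ⟩ * δ ^ k
    [k]!≈[k]!*δ^k k = sym (trans (*-congˡ (trans (^-congˡ k ([1]≈1 q)) (1^n≈1 k))) (*-identityʳ _))

    -- For s = 0, x(i,j) = j for every i, so all factors of `P` agree.
    [j]^n≈P : ∀ n j → [ + j ]⟨ q ⟩ ^ n ≈ P n j
    [j]^n≈P zero    j = refl
    [j]^n≈P (suc n) j = begin
      [ + j ]⟨ q ⟩ * [ + j ]⟨ q ⟩ ^ n   ≈⟨ *-comm _ _ ⟩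
      [ + j ]⟨ q ⟩ ^ n * [ + j ]⟨ q ⟩   ≈⟨ *-cong ([j]^n≈P n j) (reflexive (≡.cong [_]⟨ q ⟩ (identity (+ n) (+ j)))) ⟩
      P n j * [ x n j ]⟨ q ⟩            ∎
      where
      identity : ∀ n j → j ≡ 0ℤ ℤ.* n ℤ.- (0ℤ ℤ.- 1ℤ) ℤ.* j
      identity = ℤ-Solver.solve-∀

corollary13 :
  ∀ {c ℓ₁ ℓ₂} (K : HeytingField c ℓ₁ ℓ₂) (char0 : CharacteristicZero K) →
  let open HeytingField K
      open GeneralizedStirling K char0 hiding (_×_)
  in
  (s : ℕ) (h : Carrier) → h # 0# →
  (q₀ : Carrier) (q₀#0 : q₀ # 0#) (q₀-cond : q₀ ≈ 1# ⊎ NotRootOfUnity q₀) →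
  (n k : ℕ) → k ≤ n →
  let q = parameter q₀ q₀#0 q₀-cond
      1-s = 1ℤ ℤ.- + s
      p = q ^ᴾ 1-s
  in
  ((s≢1 : s ≢ 1) (s≢0 : s ≢ 0) →
    S s h q n k ≈
      (h ^ (n ∸ k) * [ + s ]⟨ q ⟩ ^ n)
        / ([ k ]!⟨ p ⟩ * [ 1-s ]⟨ q ⟩ ^ k)
          [ *-#0 ([]!-#0 k p) (^-#0 k ([]-#0 q (1-≢0 s≢1))) ]
      * (∑[ j ≤ k ]
          ((- 1#) ^ (k ∸ toℕ j)
           * q ^ℤ (+ ((k ∸ toℕ j) C 2) ℤ.* 1-s)
           * qBinomial p k (toℕ j)
           * (∏[ i < n ]
               fractionalQNumber q s s≢0 (+ toℕ j)
                 (+ suc (toℕ i) ℤ.- + toℕ j ℤ.- 1ℤ)))))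
  ×
  (s ≡ 0 →
    S s h q n k ≈
      h ^ (n ∸ k) / [ k ]!⟨ q ⟩ [ []!-#0 k q ]
      * (∑[ j ≤ k ]
          ((- 1#) ^ (k ∸ toℕ j)
           * q ^ℤ (+ ((k ∸ toℕ j) C 2))
           * qBinomial q k (toℕ j)
           * [ + toℕ j ]⟨ q ⟩ ^ n)))
corollary13 K char0 s h h#0 q₀ q₀#0 q₀-cond n k k≤n =
  (λ s≢1 s≢0 →
    let q = parameter q₀ q₀#0 q₀-cond
        open AtPower s h q
    in S≈quotient h#0 {n} {k} k≤n {c = [ + s ]⟨ q ⟩ ^ n} _ refl refl
         (binomial-sum ([ + s ]⟨ q ⟩ ^ n) n k
           {λ m → q ^ℤ (+ (m C 2) ℤ.* (1ℤ ℤ.- + s))} {λ j → ∏[ i < n ] fractional s≢0 j (toℕ i)}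
           (λ j → ^ℤ-* q ((k ∸ j) C 2) _) ([s]^n*∏≈P s≢0 n))) ,
  λ { ≡.refl →
    let q = parameter q₀ q₀#0 q₀-cond
        open AtZero h q
    in S≈quotient h#0 {n} {k} k≤n {c = 1#} _ (sym (*-identityʳ _)) ([k]!≈[k]!*δ^k k)
         (binomial-sum 1# n k {λ m → value q ^ (m C 2)} {λ j → [ + j ]⟨ q ⟩ ^ n}
           (λ j → refl) (λ j → trans (*-identityˡ _) ([j]^n≈P n j))) }
  where
  open HeytingField K using (heytingCommutativeRing)
  open HeytingCommutativeRing heytingCommutativeRing using (commutativeRing)
  open CommutativeRing commutativeRing using (1#; refl; sym; trans; *-identityˡ; *-identityʳ)
  open GeneralizedStirling K char0 hiding (_×_; S)
  open Stirling K char0
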